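{- Let $\alpha\le 1$. Suppose there is a polynomial-time algorithm that, given a VRP instance $\mathcal{I}=(V,E,w,m,Q,D)$ with complete graph $G_s$ and set of feasible routing graphs $\mathcal{F}$, computes $\hat{G}_t\in\mathcal{F}$ with $$\operatorname{GED}(G_s,\hat{G}_t)\;\ge\;\alpha\cdot\max_{G_t\in\mathcal{F}}\operatorname{GED}(G_s,G_t).$$ Then the corresponding VRP solution $\hat{\mathcal{R}}=\Phi^{ -1}(\hat{G}_t)$ (a feasible VRP solution whose routing graph is $\hat{G}_t$) satisfies $$C(\hat{\mathcal{R}})\;\le\; W_{\mathrm{total}}-\alpha\,\bigl(W_{\mathrm{total}}-C(\mathcal{R}^*)\bigr)\;=\;(1-\alpha)\,W_{\mathrm{total}}+\alpha\, C(\mathcal{R}^*),$$ where $\mathcal{R}^*$ is an optimal (minimum-cost feasible) VRP solution of the instance.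
   Context: VRP instance: a tuple $\mathcal{I}=(V,E,w,m,Q,D)$ where $V=\{0,1,\dots,n\}$ ($0$ is the depot, $1,\dots,n$ are the customers); $E=\{(i,j): i,j\in V,\ i\ne j\}$ is the set of all ordered pairs (directed arcs); $w:E\to\mathbb{R}^+$ (positive reals) is symmetric, $w(i,j)=w(j,i)$, and satisfies the triangle inequality $w(i,j)\le w(i,k)+w(k,j)$; $m$ is a positive integer (number of vehicles); $Q>0$ is the vehicle capacity; $D=(d_1,\dots,d_n)$ are real customer demands with $d_i\le Q$ for all $i$. The complete graph is $G_s=(V,E,w)$, and $W_{\mathrm{total}}=\sum_{e\in E}w(e)$. Feasible VRP solution: a family $\mathcal{R}=\{R_1,\dots,R_m\}$ of $m$ routes $R_k=(v_0^k,v_1^k,\dots,v_{l_k}^k)$ such that $v_0^k=v_{l_k}^k=0$; the intermediate vertices $v_1^k,\dots,v_{l_k-1}^k$ are customers, and there is at least one of them; every customer occurs exactly once among all intermediate positions of all routes; and for each $k$ the total demand of the customers of $R_k$ is at most $Q$. Its cost is $C(\mathcal{R})=\sum_{k=1}^m\sum_{i=0}^{l_k-1}w(v_i^k,v_{i+1}^k)$. Its routing graph is $\Phi(\mathcal{R})=(V,E_t)$ with $E_t=\bigcup_{k=1}^m\{(v_i^k,v_{i+1}^k): 0\le i\le l_k-1\}$. Feasible routing graph: a directed subgraph $G_t=(V,E_t)$, $E_t\subseteq E$, of $G_s$ such that (1) $\deg^+(0)=\deg^-(0)=m$; (2) $\deg^+(i)=\deg^-(i)=1$ for all $i\in\{1,\dots,n\}$;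 (3) $G_t$ decomposes into $m$ edge-disjoint directed cycles, each starting and ending at the depot, the cycles sharing only the depot vertex; (4) for each of these cycles, the total demand of its customers is at most $Q$. $\mathcal{F}$ is the set of feasible routing graphs. (The preimage $\Phi^{ -1}(\hat G_t)$ is unique up to reordering and reversing routes, which does not affect the cost.) The graph edit distance, with edge deletion cost $c_{\mathrm{del}}(e)=w(e)$ and edge insertion cost $0$, is $\operatorname{GED}(G_s,G_t)=\sum_{e\in E\setminus E_t}w(e)$. -}

module Defs where

open import Algebra.Apartness.Bundles using (HeytingCommutativeRing; HeytingField)
open import Algebra.Bundles using (CommutativeRing)
import Algebra.Definitions.RawMonoid as RawMonoidDefinitions
open import Data.Bool.Base using (Bool; T)
open import Data.Bool.Properties using (T?)
open import Data.Fin.Base using (Fin; zero; suc)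
import Data.Fin.Properties as Fin
open import Data.List.Base
  using (List; []; _∷_; _++_; [_]; map; concat; filter; foldr; length; allFin; tabulate; cartesianProduct)
open import Data.List.NonEmpty.Base using (List⁺; toList)
import Data.List.Membership.DecPropositional as DecMembership
open import Data.List.Membership.Propositional using (_∈_)
open import Data.List.Relation.Binary.Disjoint.Propositional using (Disjoint)
open import Data.List.Relation.Unary.Unique.Propositional using (Unique)
open import Data.Nat.Base as ℕ using (ℕ; NonZero)
open import Data.Product.Base using (∃; _×_; _,_)
open import Data.Product.Properties using (≡-dec)
open import Data.Sum.Base using (_⊎_)
open import Data.Vec.Functional using (Vector)
open import Function.Base using (_∘_)
open import Function.Bundles using (_⇔_)
open import Level using (_⊔_) renaming (suc to lsuc)
open import Relation.Binary.Core using (Rel)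
open import Relation.Binary.Definitions using (DecidableEquality)
open import Relation.Binary.PropositionalEquality using (_≡_; _≢_)
open import Relation.Binary.Structures using (IsStrictPartialOrder)
open import Relation.Nullary.Decidable using (does; ¬?)
open import Relation.Nullary.Negation using (¬_)

-- The real numbers, given axiomatically as a Cauchy-complete Archimedean ordered
-- field. The axioms are the constructive ones; in classical logic they
-- characterise ℝ up to isomorphism.
record Reals c ℓ₁ ℓ₂ : Set (lsuc (c ⊔ ℓ₁ ⊔ ℓ₂)) where
  infix 4 _<_ _≤_
  field
    heytingField : HeytingField c ℓ₁ ℓ₂

  open HeytingField heytingField public renaming (Carrier to ℝ) hiding (_-_)

  commutativeRing : CommutativeRing c ℓ₁
  commutativeRing = HeytingCommutativeRing.commutativeRing heytingCommutativeRing

  open CommutativeRing commutativeRing public using (_-_)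
  open RawMonoidDefinitions (CommutativeRing.+-rawMonoid commutativeRing) public
    using () renaming (_×_ to _·_)

  field
    _<_                    : Rel ℝ ℓ₂
    <-isStrictPartialOrder : IsStrictPartialOrder _≈_ _<_
    #⇔<⊎>                  : ∀ {x y} → (x # y) ⇔ (x < y ⊎ y < x)
    +-monoˡ-<              : ∀ {x y} z → x < y → x + z < y + z
    *-pos                  : ∀ {x y} → 0# < x → 0# < y → 0# < x * y

  _≤_ : Rel ℝ ℓ₂
  x ≤ y = ¬ (y < x)

  -- N is a modulus: for p, q ≥ N k, ∣ f p - f q ∣ < 1 / (1 + k).
  IsCauchy : (ℕ → ℝ) → (ℕ → ℕ) → Set ℓ₂
  IsCauchy f N = ∀ k p q → N k ℕ.≤ p → N k ℕ.≤ q → ℕ.suc k · (f p - f q) < 1#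

  _ConvergesTo_ : (ℕ → ℝ) → ℝ → Set ℓ₂
  f ConvergesTo x = ∀ k → ∃ λ N → ∀ p → N ℕ.≤ p →
    (ℕ.suc k · (f p - x) < 1#) × (ℕ.suc k · (x - f p) < 1#)

  field
    archimedean : ∀ x → ∃ λ n → x < n · 1#
    complete    : ∀ f N → IsCauchy f N → ∃ λ x → f ConvergesTo x

-- The depot is zero; customer i : Fin n is the vertex suc i.
Vertex : ℕ → Set
Vertex n = Fin (ℕ.suc n)

Arc : ℕ → Set
Arc n = Vertex n × Vertex n

depot : ∀ {n} → Vertex n
depot = zero

_≟ᵃ_ : ∀ {n} → DecidableEquality (Arc n)
_≟ᵃ_ = ≡-dec Fin._≟_ Fin._≟_

E : ∀ n → List (Arc n)
E n = filter (λ (i , j) → ¬? (i Fin.≟ j)) (cartesianProduct (allFin _) (allFin _))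

-- A directed graph on the vertices, given by its arc set.
Digraph : ℕ → Set
Digraph n = Arc n → Bool

infix 4 _≐_
_≐_ : ∀ {n} → Digraph n → Digraph n → Set
G ≐ H = ∀ e → G e ≡ H e

deg⁺ deg⁻ : ∀ {n} → Digraph n → Vertex n → ℕ
deg⁺ G i = length (filter (λ j → T? (G (i , j))) (allFin _))
deg⁻ G i = length (filter (λ j → T? (G (j , i))) (allFin _))

-- The closed walk (0 , v₁ , … , vₗ₋₁ , 0) with l ≥ 2, given by the customers
-- v₁ , … , vₗ₋₁.
Tour : ℕ → Set
Tour n = List⁺ (Fin n)

vertices : ∀ {n} → Tour n → List (Vertex n)
vertices t = depot ∷ map suc (toList t) ++ [ depot ]

consecutive : ∀ {a} {A : Set a} → List A → List (A × A)
consecutive (x ∷ y ∷ zs) = (x , y) ∷ consecutive (y ∷ zs)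
consecutive _            = []

arcs : ∀ {n} → Tour n → List (Arc n)
arcs t = consecutive (vertices t)

customers : ∀ {n m} → Vector (Tour n) m → List (Fin n)
customers R = concat (tabulate (toList ∘ R))

Φ : ∀ {n m} → Vector (Tour n) m → Digraph n
Φ R e = does (e ∈? concat (tabulate (arcs ∘ R)))
  where open DecMembership _≟ᵃ_ using (_∈?_)

record IsCycleDecomposition {n m} (G : Digraph n) (C : Vector (Tour n) m) : Set where
  field
    -- Makes each tour a directed cycle: no vertex is visited twice.
    simple        : ∀ k → Unique (toList (C k))
    covers        : ∀ e → T (G e) ⇔ (∃ λ k → e ∈ arcs (C k))
    edge-disjoint : ∀ k l → k ≢ l → Disjoint (arcs (C k)) (arcs (C l))
    share-depot   : ∀ k l → k ≢ l → ∀ {v} → v ∈ vertices (C k) → v ∈ vertices (C l) → v ≡ depot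

module VRP {c ℓ₁ ℓ₂} (𝓡 : Reals c ℓ₁ ℓ₂) where
  open Reals 𝓡

  Σ[_] : List ℝ → ℝ
  Σ[_] = foldr _+_ 0#

  record Instance : Set (c ⊔ ℓ₁ ⊔ ℓ₂) where
    field
      n m   : ℕ
      m≢0   : NonZero m
      -- Only the values of w off the diagonal are ever used.
      w     : Arc n → ℝ
      w-pos : ∀ {i j} → i ≢ j → 0# < w (i , j)
      w-sym : ∀ {i j} → i ≢ j → w (i , j) ≈ w (j , i)
      w-tri : ∀ {i j k} → i ≢ j → i ≢ k → k ≢ j → w (i , j) ≤ w (i , k) + w (k , j)
      Q     : ℝ
      Q-pos : 0# < Q
      d     : Fin n → ℝ
      d≤Q   : ∀ i → d i ≤ Q

  module _ (I : Instance) where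
    open Instance I

    W-total : ℝ
    W-total = Σ[ map w (E n) ]

    load : Tour n → ℝ
    load t = Σ[ map d (toList t) ]

    Routes : Set
    Routes = Vector (Tour n) m

    record IsFeasibleSolution (R : Routes) : Set ℓ₂ where
      field
        visited-once : ∀ i → length (filter (i Fin.≟_) (customers R)) ≡ 1
        capacity     : ∀ k → load (R k) ≤ Q

    C : Routes → ℝ
    C R = Σ[ tabulate (λ k → Σ[ map w (arcs (R k)) ]) ]

    record IsOptimalSolution (R : Routes) : Set ℓ₂ where
      field
        feasible : IsFeasibleSolution R
        minimal  : ∀ R′ → IsFeasibleSolution R′ → C R ≤ C R′

    record 𝓕 (G : Digraph n) : Set ℓ₂ where
      field
        subgraph       : ∀ e → T (G e) → e ∈ E n
        deg⁺-depot     : deg⁺ G depot ≡ m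
        deg⁻-depot     : deg⁻ G depot ≡ m
        deg⁺-customer  : ∀ i → deg⁺ G (suc i) ≡ 1
        deg⁻-customer  : ∀ i → deg⁻ G (suc i) ≡ 1
        cycles         : Routes
        decomposition  : IsCycleDecomposition G cycles
        capacity       : ∀ k → load (cycles k) ≤ Q

    -- GED(Gₛ , G), with deletion cost w and insertion cost 0.
    GED : Digraph n → ℝ
    GED G = Σ[ map w (filter (λ e → ¬? (T? (G e))) (E n)) ]

    record IsMaxGED (M : ℝ) : Set (ℓ₁ ⊔ ℓ₂) where
      field
        attained   : ∃ λ G → 𝓕 G × GED G ≈ M
        upperBound : ∀ G → 𝓕 G → GED G ≤ M

    IsApproximation : ℝ → Digraph n → Set (c ⊔ ℓ₁ ⊔ ℓ₂)
    IsApproximation α G = 𝓕 G × (∃ λ M → IsMaxGED M × α * M ≤ GED G)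

  -- A machine model for real-weighted instances. Since no particular one
  -- (Turing machines on encoded data, real RAM, …) is intended, it is kept abstract.
  record ComputationModel p h : Set (c ⊔ ℓ₁ ⊔ ℓ₂ ⊔ lsuc (p ⊔ h)) where
    field
      Program : Set p
      size    : Instance → ℕ
      -- Halts P I G t : on input I, P halts with output G after t steps.
      Halts   : Program → (I : Instance) → Digraph (Instance.n I) → ℕ → Set h

    -- Inputs are restricted to instances with 𝓕 inhabited: on the others
    -- there is no admissible output.
    PolynomialTime : Program → Set (c ⊔ ℓ₁ ⊔ ℓ₂ ⊔ h)
    PolynomialTime P = ∃ λ a → ∃ λ b → ∀ I → ∃ (𝓕 I) →
      ∃ λ G → ∃ λ t → Halts P I G t × t ℕ.≤ a ℕ.* size I ℕ.^ b ℕ.+ a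

    Approximates : ℝ → Program → Set (c ⊔ ℓ₁ ⊔ ℓ₂ ⊔ h)
    Approximates α P = ∀ I → ∃ (𝓕 I) → ∀ G t → Halts P I G t → IsApproximation I α G

{-# OPTIONS --safe #-}
module Submission where

-- The arcs of a feasible solution R are pairwise distinct and are exactly the arcs
-- of Φ R, so C R + GED (Φ R) = W. Since Φ maps the feasible solutions onto 𝓕,
-- minimising the cost is the same as maximising GED, hence max GED = W - C R*
-- exactly. This equality, rather than just one inequality, lets the hypothesis be
-- multiplied by α without knowing the sign of α.

open import Defs
open import Algebra.Bundles using (CommutativeRing)
import Algebra.Properties.Group as GroupProperties
import Algebra.Properties.AbelianGroup as AbelianGroupProperties
import Algebra.Properties.Ring as RingProperties
open import Data.Bool.Base using (true; false; T)
open import Data.Bool.Properties using (T?)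
open import Data.Empty using (⊥-elim)
open import Data.Fin.Base using (Fin; zero; suc)
import Data.Fin.Properties as Fin
open import Data.List.Base
  using (List; []; _∷_; _++_; [_]; map; concat; filter; length; allFin; replicate; tabulate)
open import Data.List.NonEmpty.Base using (toList) renaming (_∷_ to _∷⁺_)
import Data.List.Membership.DecPropositional as DecMembership
open import Data.List.Membership.Propositional using (_∈_)
open import Data.List.Membership.Propositional.Properties
  using (∈-map⁺; ∈-map⁻; ∈-++⁺ˡ; ∈-++⁻; ∈-concat⁺; ∈-concat⁻; ∈-filter⁺; ∈-filter⁻;
         ∈-allFin; ∈-cartesianProduct⁺; ∈-length)
open import Data.List.Membership.Propositional.Properties.WithK using (unique∧set⇒bag)
open import Data.List.Properties
  using (map-++; length-map; filter-none; filter-accept)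
open import Data.List.Relation.Binary.BagAndSetEquality using (∼bag⇒↭)
open import Data.List.Relation.Binary.Disjoint.Propositional using (Disjoint)
open import Data.List.Relation.Binary.Permutation.Propositional
  using (_↭_; ↭-refl; ↭-sym; ↭-reflexive; prep; module PermutationReasoning)
import Data.List.Relation.Binary.Permutation.Propositional as ↭
open import Data.List.Relation.Binary.Permutation.Propositional.Properties
  using (↭-length; ∷↭∷ʳ; filter-↭; shifts; ++⁺ˡ; ++⁺ʳ)
  renaming (map⁺ to ↭-map⁺)
open import Data.List.Relation.Unary.All as All using (All; []; _∷_)
import Data.List.Relation.Unary.All.Properties as All
open import Data.List.Relation.Unary.Any using (here; there)
import Data.List.Relation.Unary.Any.Properties as Any
open import Data.List.Relation.Unary.AllPairs using ([]; _∷_)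
import Data.List.Relation.Unary.AllPairs.Properties as AllPairs
open import Data.List.Relation.Unary.Unique.Propositional using (Unique)
import Data.List.Relation.Unary.Unique.Propositional.Properties as Unique
open import Data.Nat.Base as ℕ using (ℕ)
import Data.Nat.Properties as ℕ
open import Data.Product.Base using (∃; _×_; _,_; proj₁; proj₂)
open import Data.Product.Properties using (,-injectiveˡ; ,-injectiveʳ)
open import Data.Sum.Base using (inj₁; inj₂; [_,_]′)
open import Data.Vec.Functional using (Vector)
open import Function.Base using (_∘_)
open import Function.Bundles using (_⇔_; mk⇔; Equivalence)
import Relation.Binary.Reasoning.Setoid as ≈-Reasoning
open import Relation.Binary.Definitions using (DecidableEquality)
open import Relation.Binary.Structures using (IsStrictPartialOrder)
open import Relation.Binary.PropositionalEquality
  using (_≡_; _≢_; refl; sym; trans; cong; subst; module ≡-Reasoning)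
open import Relation.Nullary.Decidable using (Dec; yes; no; does; ¬?)
open import Relation.Nullary.Negation using (contradiction)
open import Relation.Unary using (Pred; Decidable)

-- Duplicate-free lists, permutations and counting.

does-⇔ : ∀ {p} {P : Set p} (P? : Dec P) → T (does P?) ⇔ P
does-⇔ (yes p) = mk⇔ (λ _ → p) _
does-⇔ (no ¬p) = mk⇔ ⊥-elim ¬p

module _ {a} {A : Set a} where

  -- Without repetitions every multiplicity is 0 or 1, so membership alone determines the bag. This
  -- turns two descriptions of the same arc set into equal lengths (degrees) and equal sums
  -- (weights).
  unique-⇔⇒↭ : ∀ {xs ys : List A} → Unique xs → Unique ys →
    (∀ {x} → x ∈ xs ⇔ x ∈ ys) → xs ↭ ys
  unique-⇔⇒↭ xs! ys! eq = ∼bag⇒↭ (unique∧set⇒bag xs! ys! eq)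

  unique-++⁻ : ∀ (xs : List A) {ys} → Unique (xs ++ ys) → Unique xs × Unique ys × Disjoint xs ys
  unique-++⁻ []       ys!         = [] , ys! , λ ()
  unique-++⁻ (x ∷ xs) (x≢ ∷ xsys!) with xs! , ys! , xs#ys ← unique-++⁻ xs xsys! =
    All.++⁻ˡ xs x≢ ∷ xs! , ys! , λ where
      (here refl , v∈ys)  → All.lookup (All.++⁻ʳ xs x≢) v∈ys refl
      (there v∈xs , v∈ys) → xs#ys (v∈xs , v∈ys)

  ∈-concat-tabulate⁺ : ∀ {m} (f : Fin m → List A) {v} k → v ∈ f k → v ∈ concat (tabulate f)
  ∈-concat-tabulate⁺ f k v∈ = ∈-concat⁺ (Any.tabulate⁺ k v∈)

  ∈-concat-tabulate⁻ : ∀ {m} (f : Fin m → List A) {v} →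
    v ∈ concat (tabulate f) → ∃ λ k → v ∈ f k
  ∈-concat-tabulate⁻ f v∈ = Any.tabulate⁻ (∈-concat⁻ (tabulate f) v∈)

  unique-concat-tabulate⁺ : ∀ {m} (f : Fin m → List A) → (∀ k → Unique (f k)) →
    (∀ k l → k ≢ l → Disjoint (f k) (f l)) → Unique (concat (tabulate f))
  unique-concat-tabulate⁺ f f! f# =
    Unique.concat⁺ (All.tabulate⁺ f!) (AllPairs.tabulate⁺ (λ {k} {l} → f# k l))

  -- Applied to the customer lists of a family of tours: the first half makes each tour simple, the
  -- second makes different tours share no customer.
  unique-concat-tabulate⁻ : ∀ {m} (f : Fin m → List A) → Unique (concat (tabulate f)) →
    (∀ k → Unique (f k)) × (∀ k l → k ≢ l → Disjoint (f k) (f l))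
  unique-concat-tabulate⁻ {ℕ.zero}  f _  = (λ ()) , λ ()
  unique-concat-tabulate⁻ {ℕ.suc m} f u
    with f₀! , fs! , f₀#fs ← unique-++⁻ (f zero) u
    with f! , f# ← unique-concat-tabulate⁻ (f ∘ suc) fs! = unique , disjoint
    where
    unique : ∀ k → Unique (f k)
    unique zero    = f₀!
    unique (suc k) = f! k
    disjoint : ∀ k l → k ≢ l → Disjoint (f k) (f l)
    disjoint zero    zero    k≢l _         = k≢l refl
    disjoint zero    (suc l) _   (p , q)   = f₀#fs (p , ∈-concat-tabulate⁺ (f ∘ suc) l q)
    disjoint (suc k) zero    _   (p , q)   = f₀#fs (q , ∈-concat-tabulate⁺ (f ∘ suc) k p)
    disjoint (suc k) (suc l) k≢l p         = f# k l (k≢l ∘ cong suc) p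

  length-filter-map : ∀ {b p} {B : Set b} {P : Pred A p} (P? : Decidable P) (f : B → A) xs →
    length (filter P? (map f xs)) ≡ length (filter (P? ∘ f) xs)
  length-filter-map P? f []       = refl
  length-filter-map P? f (x ∷ xs) with does (P? (f x))
  ... | true  = cong ℕ.suc (length-filter-map P? f xs)
  ... | false = length-filter-map P? f xs

module _ {a} {A : Set a} (_≟_ : DecidableEquality A) where

  count : A → List A → ℕ
  count x xs = length (filter (x ≟_) xs)

  count-∷-≤ : ∀ x y xs → count x xs ℕ.≤ count x (y ∷ xs)
  count-∷-≤ x y xs with does (x ≟ y)
  ... | true  = ℕ.n≤1+n _
  ... | false = ℕ.≤-refl

  -- Feasibility is phrased by counting visits, cycle decompositions by `Unique`; this is the
  -- passage from the former to the latter.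
  count≤1⇒unique : ∀ xs → (∀ x → count x xs ℕ.≤ 1) → Unique xs
  count≤1⇒unique []       _  = []
  count≤1⇒unique (x ∷ xs) ≤1 =
    -- If the head occurred again in the tail, its count would be at least 2.
    All.tabulate (λ { y∈xs refl → ℕ.<⇒≱ (twice y∈xs) (≤1 x) })
    ∷ count≤1⇒unique xs (λ y → ℕ.≤-trans (count-∷-≤ y x xs) (≤1 y))
    where
    twice : x ∈ xs → 1 ℕ.< count x (x ∷ xs)
    twice x∈xs rewrite filter-accept (x ≟_) {x} {xs} refl =
      ℕ.s<s (∈-length (∈-filter⁺ (x ≟_) x∈xs refl))

-- The arcs of a single tour.

map-proj₁-consecutive : ∀ {a} {A : Set a} (xs : List A) y →
  map proj₁ (consecutive (xs ++ [ y ])) ≡ xs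
map-proj₁-consecutive []            y = refl
map-proj₁-consecutive (x ∷ [])      y = refl
map-proj₁-consecutive (x ∷ x′ ∷ xs) y = cong (x ∷_) (map-proj₁-consecutive (x′ ∷ xs) y)

map-proj₂-consecutive : ∀ {a} {A : Set a} (x : A) ys → map proj₂ (consecutive (x ∷ ys)) ≡ ys
map-proj₂-consecutive x []       = refl
map-proj₂-consecutive x (y ∷ ys) = cong (y ∷_) (map-proj₂-consecutive y ys)

module _ {n} (t : Tour n) where

  sources : map proj₁ (arcs t) ≡ depot ∷ map suc (toList t)
  sources = map-proj₁-consecutive (depot ∷ map suc (toList t)) depot

  targets : map proj₂ (arcs t) ≡ map suc (toList t) ++ [ depot ]
  targets = map-proj₂-consecutive depot (map suc (toList t) ++ [ depot ])

  source∈vertices : ∀ {e} → e ∈ arcs t → proj₁ e ∈ vertices t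
  source∈vertices {e} e∈ = ∈-++⁺ˡ (subst (proj₁ e ∈_) sources (∈-map⁺ proj₁ e∈))

  target∈vertices : ∀ {e} → e ∈ arcs t → proj₂ e ∈ vertices t
  target∈vertices {e} e∈ = there (subst (proj₂ e ∈_) targets (∈-map⁺ proj₂ e∈))

  suc∈vertices⁻ : ∀ {i} → suc i ∈ vertices t → i ∈ toList t
  suc∈vertices⁻ (there i∈) with ∈-++⁻ (map suc (toList t)) i∈
  ... | inj₂ (here ())
  ... | inj₁ i∈′ with _ , j∈ , refl ← ∈-map⁻ suc i∈′ = j∈

  -- The sources alone already tell the arcs apart: they are the depot, once, followed by the
  -- distinct customers.
  unique-arcs : Unique (toList t) → Unique (arcs t)
  unique-arcs t! = Unique.map⁻ (subst Unique (sym sources)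
    (All.map⁺ (All.universal (λ _ ()) (toList t)) ∷ Unique.map⁺ Fin.suc-injective t!))

-- A tour has at least one customer, so its first arc goes from the depot to a customer and its last
-- one from a customer to the depot. The arcs in between join neighbours in a list of distinct
-- customers.
arc-loopless : ∀ {n} (t : Tour n) {e} → Unique (toList t) → e ∈ arcs t → proj₁ e ≢ proj₂ e
arc-loopless (i ∷⁺ is) _  (here refl) ()
arc-loopless (i ∷⁺ is) t! (there e∈) = go i is t! e∈
  where
  go : ∀ i is {e} → Unique (i ∷ is) →
    e ∈ consecutive (map suc (i ∷ is) ++ [ depot ]) → proj₁ e ≢ proj₂ e
  go i []       _                  (here refl) ()
  go i (j ∷ js) ((i≢j ∷ _) ∷ _)    (here refl) eq = i≢j (Fin.suc-injective eq)
  go i (j ∷ js) (_ ∷ js!)          (there e∈)  eq = go j js js! e∈ eq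

∈-E : ∀ {n} {e : Arc n} → proj₁ e ≢ proj₂ e → e ∈ E n
∈-E = ∈-filter⁺ (λ e → ¬? (proj₁ e Fin.≟ proj₂ e)) (∈-cartesianProduct⁺ (∈-allFin _) (∈-allFin _))

unique-E : ∀ n → Unique (E n)
unique-E n = Unique.filter⁺ (λ e → ¬? (proj₁ e Fin.≟ proj₂ e)) (Unique.cartesianProduct⁺ (Unique.allFin⁺ _) (Unique.allFin⁺ _))

-- Arcs, endpoints and degrees for a family of tours.

allArcs : ∀ {n m} → Vector (Tour n) m → List (Arc n)
allArcs R = concat (tabulate (arcs ∘ R))

-- Every tour leaves each of its vertices, the depot included, exactly once and enters it as often.
-- Sources and targets thus form the same bag, and keeping `f` general treats both at once.
endpoints-↭ : ∀ {n m} (f : Arc n → Vertex n) (R : Vector (Tour n) m) →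
  (∀ k → map f (arcs (R k)) ↭ depot ∷ map suc (toList (R k))) →
  map f (allArcs R) ↭ replicate m depot ++ map suc (customers R)
endpoints-↭ {m = ℕ.zero}  f R eq = ↭-refl
endpoints-↭ {n} {ℕ.suc m} f R eq = begin
  map f (arcs (R zero) ++ allArcs (R ∘ suc))
    ≡⟨ map-++ f (arcs (R zero)) _ ⟩
  map f (arcs (R zero)) ++ map f (allArcs (R ∘ suc))
    ↭⟨ ↭.trans (++⁺ʳ _ (eq zero)) (++⁺ˡ (depot ∷ cs₀) (endpoints-↭ f (R ∘ suc) (eq ∘ suc))) ⟩
  depot ∷ cs₀ ++ replicate m depot ++ cs
    -- The customers of the first tour move past the depots of the remaining ones.
    ↭⟨ prep depot (shifts cs₀ (replicate m depot)) ⟩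
  depot ∷ replicate m depot ++ cs₀ ++ cs
    ≡⟨ cong ((replicate (ℕ.suc m) depot) ++_) (map-++ suc (toList (R zero)) _) ⟨
  replicate (ℕ.suc m) depot ++ map suc (customers R) ∎
  where
  open PermutationReasoning
  cs₀ cs : List (Vertex n)
  cs₀ = map suc (toList (R zero))
  cs  = map suc (customers (R ∘ suc))

module _ {n m} (R : Vector (Tour n) m) where

  sources-↭ : map proj₁ (allArcs R) ↭ replicate m depot ++ map suc (customers R)
  sources-↭ = endpoints-↭ proj₁ R (λ k → ↭-reflexive (sources (R k)))

  targets-↭ : map proj₂ (allArcs R) ↭ replicate m depot ++ map suc (customers R)
  targets-↭ = endpoints-↭ proj₂ R (λ k →
    ↭.trans (↭-reflexive (targets (R k))) (↭-sym (∷↭∷ʳ depot _)))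

  T-Φ : ∀ e → T (Φ R e) ⇔ e ∈ allArcs R
  T-Φ e = does-⇔ (e ∈? allArcs R)
    where open DecMembership _≟ᵃ_ using (_∈?_)

count-depot : ∀ {n} m (is : List (Fin n)) →
  count Fin._≟_ depot (replicate m depot ++ map suc is) ≡ m
count-depot ℕ.zero    is = cong length (filter-none (depot Fin.≟_) (All.map⁺ (All.universal (λ _ ()) is)))
count-depot (ℕ.suc m) is = cong ℕ.suc (count-depot m is)

count-suc : ∀ {n} m (i : Fin n) is →
  count Fin._≟_ (suc i) (replicate m depot ++ map suc is) ≡ count Fin._≟_ i is
count-suc ℕ.zero    i []       = refl
count-suc ℕ.zero    i (j ∷ js) with ih ← count-suc ℕ.zero i js | i Fin.≟ j
... | yes _ = cong ℕ.suc ih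
... | no  _ = ih
count-suc (ℕ.suc m) i is       = count-suc m i is

-- deg⁺ is the case f = (v ,_), g = proj₁, and deg⁻ the case f = (_, v), g = proj₂.
degree-count : ∀ {n} (G : Digraph n) {as} → Unique as → (∀ e → T (G e) ⇔ e ∈ as) →
  ∀ v (f : Vertex n → Arc n) (g : Arc n → Vertex n) →
  (∀ {i j} → f i ≡ f j → i ≡ j) → (∀ j → v ≡ g (f j)) → (∀ e → v ≡ g e → ∃ λ j → e ≡ f j) →
  length (filter (λ j → T? (G (f j))) (allFin _)) ≡ count Fin._≟_ v (map g as)
degree-count {n} G {as} as! G⇔as v f g inj gf fib = begin
  length js                   ≡⟨ length-map f js ⟨
  -- Both lists enumerate, without repetition, the arcs of `G` that have `v` at the end selected by
  -- `g`: the left one runs over the opposite endpoint, the right one selects from `as`.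
  length (map f js)           ≡⟨ ↭-length (unique-⇔⇒↭ js! (Unique.filter⁺ at? as!) (mk⇔ to from)) ⟩
  length (filter at? as)      ≡⟨ length-filter-map (v Fin.≟_) g as ⟨
  count Fin._≟_ v (map g as)  ∎
  where
  open ≡-Reasoning
  G? : Decidable (T ∘ G ∘ f)
  G? j = T? (G (f j))
  at? : Decidable (λ e → v ≡ g e)
  at? e = v Fin.≟ g e
  js : List (Vertex n)
  js = filter G? (allFin _)
  js! : Unique (map f js)
  js! = Unique.map⁺ inj (Unique.filter⁺ G? (Unique.allFin⁺ _))
  to : ∀ {e} → e ∈ map f js → e ∈ filter at? as
  to e∈ with j , j∈ , refl ← ∈-map⁻ f e∈ =
    ∈-filter⁺ at? (Equivalence.to (G⇔as _) (proj₂ (∈-filter⁻ G? {xs = allFin _} j∈))) (gf j)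
  from : ∀ {e} → e ∈ filter at? as → e ∈ map f js
  from {e} e∈ with e∈as , eq ← ∈-filter⁻ at? {xs = as} e∈
              with j , refl ← fib e eq =
    ∈-map⁺ f (∈-filter⁺ G? (∈-allFin j) (Equivalence.from (G⇔as _) e∈as))

-- Cycle decompositions and routing graphs.

module _ {n m} {G : Digraph n} {R : Vector (Tour n) m} (dec : IsCycleDecomposition G R) where
  open IsCycleDecomposition dec

  decomposition-members : ∀ e → T (G e) ⇔ e ∈ allArcs R
  decomposition-members e = mk⇔
    (λ Ge → let k , e∈ = Equivalence.to (covers e) Ge in ∈-concat-tabulate⁺ (arcs ∘ R) k e∈)
    (Equivalence.from (covers e) ∘ ∈-concat-tabulate⁻ (arcs ∘ R))

  decomposition-unique : Unique (allArcs R)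
  decomposition-unique = unique-concat-tabulate⁺ (arcs ∘ R)
    (λ k → unique-arcs (R k) (simple k)) edge-disjoint

  decomposition-subgraph : ∀ e → T (G e) → e ∈ E n
  decomposition-subgraph e Ge with k , e∈ ← Equivalence.to (covers e) Ge =
    ∈-E (arc-loopless (R k) (simple k) e∈)

  -- Together with `𝓕⇒feasible` this shows that `Φ` reaches every feasible routing graph, up to `≐`.
  decomposition-Φ : Φ R ≐ G
  decomposition-Φ e with G e in eq | DecMembership._∈?_ _≟ᵃ_ e (allArcs R)
  ... | true  | yes _  = refl
  ... | false | no _   = refl
  ... | true  | no e∉  = contradiction (Equivalence.to (decomposition-members e) (subst T (sym eq) _)) e∉
  ... | false | yes e∈ = ⊥-elim (subst T eq (Equivalence.from (decomposition-members e) e∈))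

  -- Since no arc is repeated, the out-degree of `v` is the number of times `v` occurs as a source.
  -- For a customer this is its number of visits, which links the degree conditions with
  -- `visited-once` in both directions.
  decomposition-deg⁺ : ∀ v → deg⁺ G v ≡ count Fin._≟_ v (replicate m depot ++ map suc (customers R))
  decomposition-deg⁺ v = trans
    (degree-count G decomposition-unique decomposition-members v (v ,_) proj₁
      ,-injectiveʳ (λ _ → refl) (λ { (_ , j) refl → j , refl }))
    (↭-length (filter-↭ (v Fin.≟_) (sources-↭ R)))

  decomposition-deg⁻ : ∀ v → deg⁻ G v ≡ count Fin._≟_ v (replicate m depot ++ map suc (customers R))
  decomposition-deg⁻ v = trans
    (degree-count G decomposition-unique decomposition-members v (_, v) proj₂
      ,-injectiveˡ (λ _ → refl) (λ { (j , _) refl → j , refl }))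
    (↭-length (filter-↭ (v Fin.≟_) (targets-↭ R)))

-- Distinctness of all visits yields both simplicity and disjointness of the tours. The graph is
-- only required to agree pointwise with `Φ R`, so that the lemma also applies to the output of the
-- algorithm.
unique⇒decomposition : ∀ {n m} {G : Digraph n} (R : Vector (Tour n) m) →
  Unique (customers R) → Φ R ≐ G → IsCycleDecomposition G R
unique⇒decomposition {n} {G = G} R R! Φ≐G
  with simple , disjoint ← unique-concat-tabulate⁻ (toList ∘ R) R! = record
  { simple        = simple
  ; covers        = λ e → mk⇔
      (λ Ge → ∈-concat-tabulate⁻ (arcs ∘ R) (Equivalence.to (T-Φ R e) (subst T (sym (Φ≐G e)) Ge)))
      (λ (k , e∈) → subst T (Φ≐G e) (Equivalence.from (T-Φ R e) (∈-concat-tabulate⁺ (arcs ∘ R) k e∈)))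
  -- Both endpoints of an arc common to two tours would be the depot, making it a loop.
  ; edge-disjoint = λ k l k≢l (p , q) → arc-loopless (R k) (simple k) p (trans
      (share k l k≢l (source∈vertices (R k) p) (source∈vertices (R l) q))
      (sym (share k l k≢l (target∈vertices (R k) p) (target∈vertices (R l) q))))
  ; share-depot   = share
  }
  where
  share : ∀ k l → k ≢ l → ∀ {v} → v ∈ vertices (R k) → v ∈ vertices (R l) → v ≡ depot
  share k l k≢l {zero}  _ _ = refl
  share k l k≢l {suc i} p q =
    contradiction (suc∈vertices⁻ (R k) p , suc∈vertices⁻ (R l) q) (disjoint k l k≢l)

-- Order and finite sums in the reals.

module _ {c ℓ₁ ℓ₂} (𝓡 : Reals c ℓ₁ ℓ₂) where
  open Reals 𝓡 using (ℝ; _<_; _≤_; +-monoˡ-<; #⇔<⊎>; tight; <-isStrictPartialOrder)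
  open CommutativeRing (Reals.commutativeRing 𝓡) hiding (refl; sym; trans; zero; Carrier)
  open CommutativeRing (Reals.commutativeRing 𝓡) using () renaming (refl to ≈-refl; sym to ≈-sym; trans to ≈-trans)
  open IsStrictPartialOrder <-isStrictPartialOrder using (<-respˡ-≈; <-respʳ-≈)
  open VRP 𝓡
  open GroupProperties +-group using (//-rightDividesˡ; //-rightDividesʳ)
  open AbelianGroupProperties +-abelianGroup using (⁻¹-anti-homo‿-)
  open RingProperties ring using (-‿distribʳ-*; -‿distribˡ-*)

  -- As `≤` is a negated `<`, the two hypotheses exclude both ways of being apart, and apartness is
  -- tight.
  ≤-antisym : ∀ {x y} → x ≤ y → y ≤ x → x ≈ y
  ≤-antisym x≤y y≤x = proj₁ (tight _ _) λ x#y → [ y≤x , x≤y ]′ (Equivalence.to #⇔<⊎> x#y)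

  ≤-respˡ-≈ : ∀ {x x′ y} → x ≈ x′ → x ≤ y → x′ ≤ y
  ≤-respˡ-≈ eq x≤y y<x′ = x≤y (<-respʳ-≈ (≈-sym eq) y<x′)

  ≤-respʳ-≈ : ∀ {x y y′} → y ≈ y′ → x ≤ y → x ≤ y′
  ≤-respʳ-≈ eq x≤y y′<x = x≤y (<-respˡ-≈ (≈-sym eq) y′<x)

  +-cancelʳ-< : ∀ {x y} z → x + z < y + z → x < y
  +-cancelʳ-< {x} {y} z lt =
    <-respˡ-≈ (//-rightDividesʳ z x) (<-respʳ-≈ (//-rightDividesʳ z y) (+-monoˡ-< (- z) lt))

  -- If `y < y′`, then `x′ + y < x′ + y′ ≈ x + y`, and cancelling `y` gives `x′ < x`. With `s` the
  -- total weight, this exchanges bounds on cost for bounds on edit distance.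
  complement-antitone : ∀ {s x y x′ y′} → x + y ≈ s → x′ + y′ ≈ s → x ≤ x′ → y′ ≤ y
  complement-antitone {s} {x} {y} {x′} {y′} eq eq′ x≤x′ y<y′ =
    x≤x′ (+-cancelʳ-< y (<-respʳ-≈ x′+y′≈x+y (<-respˡ-≈ (+-comm y x′) (+-monoˡ-< x′ y<y′))))
    where
    x′+y′≈x+y : y′ + x′ ≈ x + y
    x′+y′≈x+y = ≈-trans (+-comm y′ x′) (≈-trans eq′ (≈-sym eq))

  module ≈R = ≈-Reasoning setoid

  interpolation : ∀ α W C → W - α * (W - C) ≈ (1# - α) * W + α * C
  interpolation α W C = begin
    W - α * (W - C)                ≈⟨ +-congˡ (-‿distribʳ-* α (W - C)) ⟩
    W + α * - (W - C)              ≈⟨ +-congˡ (*-congˡ (⁻¹-anti-homo‿- W C)) ⟩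
    W + α * (C - W)                ≈⟨ +-congˡ (distribˡ α C (- W)) ⟩
    W + (α * C + α * - W)          ≈⟨ +-congˡ (+-comm _ _) ⟩
    W + (α * - W + α * C)          ≈⟨ +-assoc _ _ _ ⟨
    W + α * - W + α * C            ≈⟨ +-congʳ (+-cong (*-identityˡ W) (≈-trans (≈-sym (-‿distribˡ-* α W)) (-‿distribʳ-* α W))) ⟨
    1# * W + - α * W + α * C       ≈⟨ +-congʳ (distribʳ W 1# (- α)) ⟨
    (1# - α) * W + α * C           ∎
    where open ≈R

  Σ-++ : ∀ xs ys → Σ[ xs ++ ys ] ≈ Σ[ xs ] + Σ[ ys ]
  Σ-++ []       ys = ≈-sym (+-identityˡ _)
  Σ-++ (x ∷ xs) ys = ≈-trans (+-congˡ (Σ-++ xs ys)) (≈-sym (+-assoc x _ _))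

  swapˡ : ∀ x y z → x + (y + z) ≈ y + (x + z)
  swapˡ x y z = ≈-trans (≈-sym (+-assoc x y z)) (≈-trans (+-congʳ (+-comm x y)) (+-assoc y x z))

  Σ-↭ : ∀ {xs ys} → xs ↭ ys → Σ[ xs ] ≈ Σ[ ys ]
  Σ-↭ ↭.refl         = ≈-refl
  Σ-↭ (prep x p)     = +-congˡ (Σ-↭ p)
  Σ-↭ (↭.swap x y p) = ≈-trans (swapˡ x y _) (+-congˡ (+-congˡ (Σ-↭ p)))
  Σ-↭ (↭.trans p q)  = ≈-trans (Σ-↭ p) (Σ-↭ q)

  -- The cost is summed tour by tour, whereas the edit distance is a single sum over arcs; this
  -- brings the cost into the second form.
  Σ-concat-tabulate : ∀ {a} {A : Set a} {m} (w : A → ℝ) (f : Fin m → List A) →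
    Σ[ tabulate (λ k → Σ[ map w (f k) ]) ] ≈ Σ[ map w (concat (tabulate f)) ]
  Σ-concat-tabulate {m = ℕ.zero}  w f = ≈-refl
  Σ-concat-tabulate {m = ℕ.suc m} w f = begin
    Σ[ map w (f zero) ] + Σ[ tabulate (λ k → Σ[ map w (f (suc k)) ]) ]
      ≈⟨ +-congˡ (Σ-concat-tabulate w (f ∘ suc)) ⟩
    Σ[ map w (f zero) ] + Σ[ map w (concat (tabulate (f ∘ suc))) ]
      ≈⟨ Σ-++ (map w (f zero)) _ ⟨
    Σ[ map w (f zero) ++ map w (concat (tabulate (f ∘ suc))) ]
      ≡⟨ cong Σ[_] (map-++ w (f zero) _) ⟨
    Σ[ map w (concat (tabulate f)) ] ∎
    where open ≈R

  Σ-filter : ∀ {a p} {A : Set a} {P : Pred A p} (P? : Decidable P) (w : A → ℝ) xs →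
    Σ[ map w (filter P? xs) ] + Σ[ map w (filter (λ x → ¬? (P? x)) xs) ] ≈ Σ[ map w xs ]
  Σ-filter P? w []       = +-identityˡ _
  Σ-filter P? w (x ∷ xs) with does (P? x)
  ... | true  = ≈-trans (+-assoc (w x) _ _) (+-congˡ (Σ-filter P? w xs))
  ... | false = ≈-trans (swapˡ _ (w x) _) (+-congˡ (Σ-filter P? w xs))

  -- Cost against graph edit distance on one instance.

  module _ (I : Instance) where
    open Instance I

    -- The arcs of `E n` kept by `G` are a rearrangement of the arcs travelled, so the cost is the
    -- weight of the kept arcs; the edit distance is the weight of the others.
    C+GED≈W : ∀ {G} {R : Routes I} → IsCycleDecomposition G R → C I R + GED I G ≈ W-total I
    C+GED≈W {G} {R} dec = begin
      C I R + GED I G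
        ≈⟨ +-congʳ (Σ-concat-tabulate w (arcs ∘ R)) ⟩
      Σ[ map w (allArcs R) ] + GED I G
        ≈⟨ +-congʳ (Σ-↭ (↭-map⁺ w kept)) ⟨
      Σ[ map w (filter G? (E n)) ] + GED I G
        ≈⟨ Σ-filter G? w (E n) ⟩
      W-total I ∎
      where
      open ≈R
      G? : Decidable (T ∘ G)
      G? e = T? (G e)
      kept : filter G? (E n) ↭ allArcs R
      kept = unique-⇔⇒↭ (Unique.filter⁺ G? (unique-E n)) (decomposition-unique dec) (λ {e} → mk⇔
        (λ e∈ → Equivalence.to (decomposition-members dec e) (proj₂ (∈-filter⁻ G? {xs = E n} e∈)))
        (λ e∈ → let Ge = Equivalence.from (decomposition-members dec e) e∈ in
                ∈-filter⁺ G? (decomposition-subgraph dec e Ge) Ge))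

    feasible⇒unique : ∀ {R} → IsFeasibleSolution I R → Unique (customers R)
    feasible⇒unique {R} feas = count≤1⇒unique Fin._≟_ (customers R)
      (λ i → ℕ.≤-reflexive (IsFeasibleSolution.visited-once feas i))

    feasible⇒decomposition : ∀ {R G} → IsFeasibleSolution I R → Φ R ≐ G → IsCycleDecomposition G R
    feasible⇒decomposition {R} feas = unique⇒decomposition R (feasible⇒unique feas)

    -- Each of the `m` tours contributes one depot to the sources and one to the targets, which
    -- gives the depot degrees; the customer degrees are the visit counts.
    feasible⇒𝓕 : ∀ {R} → IsFeasibleSolution I R → 𝓕 I (Φ R)
    feasible⇒𝓕 {R} feas = record
      { subgraph      = decomposition-subgraph dec
      ; deg⁺-depot    = trans (decomposition-deg⁺ dec depot) (count-depot m (customers R))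
      ; deg⁻-depot    = trans (decomposition-deg⁻ dec depot) (count-depot m (customers R))
      ; deg⁺-customer = λ i → trans (decomposition-deg⁺ dec (suc i))
          (trans (count-suc m i (customers R)) (visited-once i))
      ; deg⁻-customer = λ i → trans (decomposition-deg⁻ dec (suc i))
          (trans (count-suc m i (customers R)) (visited-once i))
      ; cycles        = R
      ; decomposition = dec
      ; capacity      = capacity
      }
      where
      open IsFeasibleSolution feas
      dec : IsCycleDecomposition (Φ R) R
      dec = feasible⇒decomposition feas (λ _ → refl)

    𝓕⇒feasible : ∀ {G} (F : 𝓕 I G) → IsFeasibleSolution I (𝓕.cycles F)
    𝓕⇒feasible {G} F = record
      { visited-once = λ i → trans
          (sym (trans (decomposition-deg⁺ decomposition (suc i)) (count-suc m i (customers cycles))))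
          (deg⁺-customer i)
      ; capacity     = capacity
      }
      where open 𝓕 F

    maxGED≈W-C* : ∀ {R M} → IsOptimalSolution I R → IsMaxGED I M → M ≈ W-total I - C I R
    maxGED≈W-C* {R} {M} opt max with G , F , GED≈M ← IsMaxGED.attained max = begin
      M                                 ≈⟨ GED≈M ⟨
      GED I G                           ≈⟨ ≤-antisym below above ⟩
      GED I (Φ R)                       ≈⟨ //-rightDividesʳ (C I R) _ ⟨
      GED I (Φ R) + C I R - C I R       ≈⟨ +-congʳ (≈-trans (+-comm _ _) total*) ⟩
      W-total I - C I R                 ∎
      where
      open ≈R
      open IsOptimalSolution opt
      total* : C I R + GED I (Φ R) ≈ W-total I
      total* = C+GED≈W (feasible⇒decomposition feasible (λ _ → refl))
      -- The cycles of `F` form a feasible solution, hence cost at least as much as `R`; the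
      -- complements in the total weight compare the other way.
      below : GED I G ≤ GED I (Φ R)
      below = complement-antitone total* (C+GED≈W (𝓕.decomposition F)) (minimal _ (𝓕⇒feasible F))
      above : GED I (Φ R) ≤ GED I G
      above = ≤-respʳ-≈ (≈-sym GED≈M) (IsMaxGED.upperBound max _ (feasible⇒𝓕 feasible))

theorem3 : ∀ {c ℓ₁ ℓ₂ p h} (𝓡 : Reals c ℓ₁ ℓ₂) →
    let open Reals 𝓡
        open VRP 𝓡
    in
    (𝓜 : ComputationModel p h) →
    let open ComputationModel 𝓜 in
    (α : ℝ) → α ≤ 1# →
    (P : Program) → PolynomialTime P → Approximates α P →
    (I : Instance) →
    let W = W-total I in
    (Ĝ : Digraph (Instance.n I)) (t : ℕ) → Halts P I Ĝ t →
    (R* : Routes I) → IsOptimalSolution I R* →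
    (∃ λ R̂ → IsFeasibleSolution I R̂ × Φ R̂ ≐ Ĝ) ×
    (∀ R̂ → IsFeasibleSolution I R̂ → Φ R̂ ≐ Ĝ →
      C I R̂ ≤ W - α * (W - C I R*)) ×
    (W - α * (W - C I R*) ≈ (1# - α) * W + α * C I R*)
theorem3 𝓡 𝓜 α _ P _ approximates I Ĝ t halts R* opt
  -- The routing graph of the optimal solution witnesses that `𝓕` is inhabited, as the guarantee of
  -- the algorithm demands.
  with F , M , max , αM≤GED ← approximates I (_ , feasible⇒𝓕 𝓡 I (VRP.IsOptimalSolution.feasible opt)) Ĝ t halts =
    (𝓕.cycles F , 𝓕⇒feasible 𝓡 I F , decomposition-Φ (𝓕.decomposition F))
  -- Complements are taken in `W`: that of `α * (W - C I R*)` is the claimed bound, and that of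
  -- `GED I Ĝ` is the cost of `R̂`.
  , (λ R̂ feas Φ≐Ĝ → complement-antitone 𝓡
      (≈-trans (+-comm _ _) (//-rightDividesˡ _ W))
      (≈-trans (+-comm _ _) (C+GED≈W 𝓡 I (feasible⇒decomposition 𝓡 I feas Φ≐Ĝ)))
      (≤-respˡ-≈ 𝓡 (*-congˡ (maxGED≈W-C* 𝓡 I opt max)) αM≤GED))
  , interpolation 𝓡 α W (C I R*)
  where
  open VRP 𝓡
  open CommutativeRing (Reals.commutativeRing 𝓡)
    using (_*_; *-congˡ; +-comm; +-group) renaming (trans to ≈-trans)
  open GroupProperties +-group using (//-rightDividesˡ)
  W = W-total I
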